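{- Let $n\ge1$ be odd and $m\ge 2$ be even. Then every $\mathbf{v}\in\mathbb{Z}_m^n$ that has a predecessor has exactly two predecessors. Moreover, if $(x_1,\dots,x_n)$ is one predecessor of $\mathbf{v}$, then the other is $(\tfrac m2+x_1,\tfrac m2+x_2,\dots,\tfrac m2+x_n)$ (entries mod $m$).
   Context: The Ducci function $D:\mathbb{Z}_m^n\to\mathbb{Z}_m^n$ is $D(x_1,\dots,x_n)=(x_1+x_2,\,x_2+x_3,\,\dots,\,x_{n-1}+x_n,\,x_n+x_1)$, entries mod $m$. A predecessor of $\mathbf{v}$ is any $\mathbf{w}\in\mathbb{Z}_m^n$ with $D(\mathbf{w})=\mathbf{v}$. -}

module Defs where

open import Data.Fin.Base using (Fin; toℕ)
open import Data.Nat.Base using (ℕ; suc; _+_; NonZero)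
open import Data.Nat.DivMod using (_/_; _mod_)
open import Data.Product.Base using (_×_; ∃-syntax)
open import Data.Sum.Base using (_⊎_)
open import Data.Vec.Base using (Vec; lookup; map; tabulate)
open import Relation.Binary.PropositionalEquality.Core using (_≡_; _≢_)

-- ℤ mod m, by least residues, so that _≡_ is equality of residue classes.
ℤ/ : ℕ → Set
ℤ/ m = Fin m

infixl 6 _⊕_

_⊕_ : ∀ {m} .{{_ : NonZero m}} → ℤ/ m → ℤ/ m → ℤ/ m
_⊕_ {m} x y = (toℕ x + toℕ y) mod m

-- Positions are numbered 0, …, n-1; the successor of n-1 is 0.
next : ∀ {n} .{{_ : NonZero n}} → Fin n → Fin n
next {n} i = suc (toℕ i) mod n

D : ∀ {n m} .{{_ : NonZero n}} .{{_ : NonZero m}} → Vec (ℤ/ m) n → Vec (ℤ/ m) n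
D x = tabulate λ i → lookup x i ⊕ lookup x (next i)

_IsPredecessorOf_ : ∀ {n m} .{{_ : NonZero n}} .{{_ : NonZero m}} →
                    Vec (ℤ/ m) n → Vec (ℤ/ m) n → Set
w IsPredecessorOf v = D w ≡ v

ExactlyTwo : {A : Set} → (A → Set) → Set
ExactlyTwo P = ∃[ a ] ∃[ b ] a ≢ b × P a × P b × (∀ c → P c → c ≡ a ⊎ c ≡ b)

-- b satisfies P, differs from a, and is the only such element.
_IsTheOther_Than_ : {A : Set} → A → (A → Set) → A → Set
b IsTheOther P Than a = P b × b ≢ a × (∀ c → P c → c ≢ a → c ≡ b)

half : ∀ m .{{_ : NonZero m}} → ℤ/ m
half m = (m / 2) mod m

addHalf : ∀ {n m} .{{_ : NonZero m}} → Vec (ℤ/ m) n → Vec (ℤ/ m) n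
addHalf {m = m} x = map (half m ⊕_) x

{-# OPTIONS --safe #-}
-- Let D x = D y and write yᵢ = c + xᵢ at one position i.  Then cancelling in
-- xᵢ + xᵢ₊₁ = yᵢ + yᵢ₊₁ gives xᵢ₊₁ = c + yᵢ₊₁: the roles of x and y are swapped.
-- Going once around the cycle, an odd number of swaps, gives both y₀ = c + x₀ and
-- x₀ = c + y₀, so c + c = 0 and c is 0 or m/2.  Since c = -c, the swaps no longer
-- matter and y = c + x at every position.
module Submission where

open import Defs
open import Algebra.Bundles using (AbelianGroup)
open import Algebra.Structures using (IsAbelianGroup)
import Algebra.Properties.AbelianGroup as AbelianGroupProperties
import Algebra.Properties.CommutativeSemigroup as CommutativeSemigroupProperties
open import Data.Empty using (⊥-elim)
open import Data.Fin.Base using (Fin; toℕ)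
open import Data.Fin.Properties using (toℕ-fromℕ<; toℕ-injective; toℕ<n)
open import Data.Nat.Base using (ℕ; zero; suc; _+_; _*_; _∸_; _≤_; s≤s; z≤n; NonZero; >-nonZero⁻¹)
open import Data.Nat.DivMod using (_/_; _%_; _mod_; %-distribˡ-+; m%n%n≡m%n; m<n⇒m%n≡m; n%n≡0; m/n<m; m/n*n≡m)
open import Data.Nat.Divisibility using (_∣_; _∤_; divides; m%n≡0⇒n∣m)
open import Data.Nat.Properties using (+-assoc; +-comm; +-identityʳ; *-comm; *-cancelʳ-≡; *-monoˡ-≤; +-mono-<; m∸n+n≡m; <⇒≤; <⇒≱; >⇒≢)
open import Data.Product.Base using (_×_; _,_; ∃-syntax)
open import Data.Sum.Base as Sum using (_⊎_; inj₁; inj₂; fromInj₂)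
open import Data.Vec.Base using (Vec; lookup)
open import Data.Vec.Properties using (lookup∘tabulate; lookup-map; tabulate-cong)
open import Data.Vec.Relation.Binary.Pointwise.Extensional using (ext; Pointwise-≡⇒≡)
open import Level using (0ℓ)
open import Relation.Binary.PropositionalEquality
open ≡-Reasoning

-- Residues and the cyclic successor

k*2≡k+k : ∀ k → k * 2 ≡ k + k
k*2≡k+k k = trans (*-comm k 2) (cong (k +_) (+-identityʳ k))

toℕ-mod : ∀ k d .{{_ : NonZero d}} → toℕ (k mod d) ≡ k % d
toℕ-mod k d = toℕ-fromℕ< _

mod-cong-% : ∀ {j k} d .{{_ : NonZero d}} → j % d ≡ k % d → j mod d ≡ k mod d
mod-cong-% {j} {k} d eq =
  toℕ-injective (trans (toℕ-mod j d) (trans eq (sym (toℕ-mod k d))))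

toℕ-mod-id : ∀ {d} .{{_ : NonZero d}} (i : Fin d) → toℕ i mod d ≡ i
toℕ-mod-id {d} i = toℕ-injective (trans (toℕ-mod (toℕ i) d) (m<n⇒m%n≡m (toℕ<n i)))

-- Lets positions on the cycle be named by unbounded indices: stepping past the last position is
-- then plain `suc`, with the wrap-around hidden in `mod`.
next-mod : ∀ k n .{{_ : NonZero n}} → next (k mod n) ≡ suc k mod n
next-mod k n = mod-cong-% n (begin
  suc (toℕ (k mod n)) % n      ≡⟨ cong (λ j → suc j % n) (toℕ-mod k n) ⟩
  suc (k % n) % n              ≡⟨ %-distribˡ-+ 1 (k % n) n ⟩
  (1 % n + k % n % n) % n      ≡⟨ cong (λ j → (1 % n + j) % n) (m%n%n≡m%n k n) ⟩
  (1 % n + k % n) % n          ≡⟨ %-distribˡ-+ 1 k n ⟨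
  suc k % n                    ∎)

-- The additive group of residues mod `m`

module _ (m : ℕ) .{{_ : NonZero m}} where

  -- Reduction is additive, so the group laws can be pulled back to arithmetic in ℕ once each
  -- residue `x` is written as `toℕ x mod m`.
  mod-⊕ : ∀ j k → (j mod m) ⊕ (k mod m) ≡ (j + k) mod m
  mod-⊕ j k = mod-cong-% m (begin
    (toℕ (j mod m) + toℕ (k mod m)) % m  ≡⟨ cong₂ (λ a b → (a + b) % m) (toℕ-mod j m) (toℕ-mod k m) ⟩
    (j % m + k % m) % m                  ≡⟨ %-distribˡ-+ j k m ⟨
    (j + k) % m                          ∎)

  0# : ℤ/ m
  0# = 0 mod m

  -- At the zero residue the difference is `m` itself; the outer `mod` brings it back to zero.
  ⊖_ : ℤ/ m → ℤ/ m
  ⊖ x = (m ∸ toℕ x) mod m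

  ⊕-comm : (x y : ℤ/ m) → x ⊕ y ≡ y ⊕ x
  ⊕-comm x y = cong (_mod m) (+-comm (toℕ x) (toℕ y))

  ⊕-assoc : (x y z : ℤ/ m) → (x ⊕ y) ⊕ z ≡ x ⊕ (y ⊕ z)
  ⊕-assoc x y z = begin
    (x ⊕ y) ⊕ z                           ≡⟨ cong ((x ⊕ y) ⊕_) (toℕ-mod-id z) ⟨
    (x ⊕ y) ⊕ (toℕ z mod m)               ≡⟨ mod-⊕ (toℕ x + toℕ y) (toℕ z) ⟩
    (toℕ x + toℕ y + toℕ z) mod m         ≡⟨ cong (_mod m) (+-assoc (toℕ x) (toℕ y) (toℕ z)) ⟩
    (toℕ x + (toℕ y + toℕ z)) mod m       ≡⟨ mod-⊕ (toℕ x) (toℕ y + toℕ z) ⟨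
    (toℕ x mod m) ⊕ (y ⊕ z)               ≡⟨ cong (_⊕ (y ⊕ z)) (toℕ-mod-id x) ⟩
    x ⊕ (y ⊕ z)                           ∎

  ⊕-identityˡ : (x : ℤ/ m) → 0# ⊕ x ≡ x
  ⊕-identityˡ x = begin
    0# ⊕ x              ≡⟨ cong (0# ⊕_) (toℕ-mod-id x) ⟨
    0# ⊕ (toℕ x mod m)  ≡⟨ mod-⊕ 0 (toℕ x) ⟩
    toℕ x mod m         ≡⟨ toℕ-mod-id x ⟩
    x                   ∎

  m-mod-m : m mod m ≡ 0#
  m-mod-m = mod-cong-% m (trans (n%n≡0 m) (sym (m<n⇒m%n≡m (>-nonZero⁻¹ m))))

  ⊕-inverseˡ : (x : ℤ/ m) → (⊖ x) ⊕ x ≡ 0#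
  ⊕-inverseˡ x = begin
    (⊖ x) ⊕ x                  ≡⟨ cong ((⊖ x) ⊕_) (toℕ-mod-id x) ⟨
    (⊖ x) ⊕ (toℕ x mod m)      ≡⟨ mod-⊕ (m ∸ toℕ x) (toℕ x) ⟩
    (m ∸ toℕ x + toℕ x) mod m  ≡⟨ cong (_mod m) (m∸n+n≡m (<⇒≤ (toℕ<n x))) ⟩
    m mod m                    ≡⟨ m-mod-m ⟩
    0#                         ∎

  ⊕-isAbelianGroup : IsAbelianGroup _≡_ _⊕_ 0# ⊖_
  ⊕-isAbelianGroup = record
    { isGroup = record
      { isMonoid = record
        { isSemigroup = record
          { isMagma = record { isEquivalence = isEquivalence ; ∙-cong = cong₂ _⊕_ }
          ; assoc = ⊕-assoc
          }
        ; identity = ⊕-identityˡ , λ x → trans (⊕-comm x 0#) (⊕-identityˡ x)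
        }
      ; inverse = ⊕-inverseˡ , λ x → trans (⊕-comm x (⊖ x)) (⊕-inverseˡ x)
      ; ⁻¹-cong = cong ⊖_
      }
    ; comm = ⊕-comm
    }

  ⊕-abelianGroup : AbelianGroup 0ℓ 0ℓ
  ⊕-abelianGroup = record { isAbelianGroup = ⊕-isAbelianGroup }

  private
    module G = AbelianGroup ⊕-abelianGroup
    open AbelianGroupProperties ⊕-abelianGroup using (∙-cancelˡ; identityˡ-unique)
    open CommutativeSemigroupProperties G.commutativeSemigroup using (interchange)

  -- Solutions of `c ⊕ c ≡ 0#`

  toℕ-0# : toℕ 0# ≡ 0
  toℕ-0# = trans (toℕ-mod 0 m) (m<n⇒m%n≡m (>-nonZero⁻¹ m))

  -- Since `m / 2 < m`, the reduction in `half m` changes nothing, and doubling a zero half would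
  -- make `m` zero.
  half≢0 : 2 ∣ m → half m ≢ 0#
  half≢0 2∣m half≡0 = >⇒≢ (>-nonZero⁻¹ m) (begin
    m                    ≡⟨ m/n*n≡m 2∣m ⟨
    m / 2 * 2            ≡⟨ cong (_* 2) (m<n⇒m%n≡m (m/n<m m 2 (s≤s (s≤s z≤n)))) ⟨
    (m / 2) % m * 2      ≡⟨ cong (_* 2) (toℕ-mod (m / 2) m) ⟨
    toℕ (half m) * 2     ≡⟨ cong (λ h → toℕ h * 2) half≡0 ⟩
    toℕ 0# * 2           ≡⟨ cong (_* 2) toℕ-0# ⟩
    0                    ∎)

  half⊕half≡0 : 2 ∣ m → half m ⊕ half m ≡ 0#
  half⊕half≡0 2∣m = begin
    half m ⊕ half m        ≡⟨ mod-⊕ (m / 2) (m / 2) ⟩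
    (m / 2 + m / 2) mod m  ≡⟨ cong (_mod m) (trans (sym (k*2≡k+k (m / 2))) (m/n*n≡m 2∣m)) ⟩
    m mod m                ≡⟨ m-mod-m ⟩
    0#                     ∎

  -- The natural number `toℕ c + toℕ c` is a multiple of `m` and lies below `m + m`, so the quotient
  -- is 0 or 1; each value determines `c`.
  c⊕c≡0⇒c≡0⊎c≡half : 2 ∣ m → (c : ℤ/ m) → c ⊕ c ≡ 0# → c ≡ 0# ⊎ c ≡ half m
  c⊕c≡0⇒c≡0⊎c≡half 2∣m c eq with m%n≡0⇒n∣m (toℕ c + toℕ c) m 2c%m≡0
    where
    2c%m≡0 : (toℕ c + toℕ c) % m ≡ 0
    2c%m≡0 = begin
      (toℕ c + toℕ c) % m  ≡⟨ toℕ-mod (toℕ c + toℕ c) m ⟨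
      toℕ (c ⊕ c)          ≡⟨ cong toℕ eq ⟩
      toℕ 0#               ≡⟨ toℕ-0# ⟩
      0                    ∎
  ... | divides 0 2c≡0 = inj₁ (trans (sym (toℕ-mod-id c)) (cong (_mod m) c≡0))
    where
    c≡0 : toℕ c ≡ 0
    c≡0 = *-cancelʳ-≡ (toℕ c) 0 2 (trans (k*2≡k+k (toℕ c)) 2c≡0)
  ... | divides 1 2c≡m = inj₂ (trans (sym (toℕ-mod-id c)) (cong (_mod m) c≡m/2))
    where
    c≡m/2 : toℕ c ≡ m / 2
    c≡m/2 = *-cancelʳ-≡ (toℕ c) (m / 2) 2 (begin
      toℕ c * 2      ≡⟨ k*2≡k+k (toℕ c) ⟩
      toℕ c + toℕ c  ≡⟨ 2c≡m ⟩
      m + 0          ≡⟨ +-identityʳ m ⟩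
      m              ≡⟨ m/n*n≡m 2∣m ⟨
      m / 2 * 2      ∎)
  ... | divides (suc (suc q)) 2c≡qm =
    ⊥-elim (<⇒≱ (+-mono-< (toℕ<n c) (toℕ<n c)) m+m≤2c)
    where
    m+m≤2c : m + m ≤ toℕ c + toℕ c
    -- `2 * m` computes to `m + (m + 0)`, so the trailing zero has to be removed.
    m+m≤2c = subst₂ _≤_ (cong (m +_) (+-identityʳ m)) (sym 2c≡qm)
               (*-monoˡ-≤ m (s≤s (s≤s (z≤n {q}))))

  -- Propagating a shift along two sequences with equal neighbour sums

  swap : ∀ {a a′ b b′ c : ℤ/ m} → a ⊕ a′ ≡ b ⊕ b′ → b ≡ c ⊕ a → a′ ≡ c ⊕ b′
  swap {a} {a′} {b} {b′} {c} sums b≡c⊕a = ∙-cancelˡ a a′ (c ⊕ b′) (begin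
    a ⊕ a′          ≡⟨ sums ⟩
    b ⊕ b′          ≡⟨ cong (_⊕ b′) b≡c⊕a ⟩
    (c ⊕ a) ⊕ b′    ≡⟨ cong (_⊕ b′) (⊕-comm c a) ⟩
    (a ⊕ c) ⊕ b′    ≡⟨ ⊕-assoc a c b′ ⟩
    a ⊕ (c ⊕ b′)    ∎)

  module _ (X Y : ℕ → ℤ/ m) (c : ℤ/ m) (sums : ∀ k → X k ⊕ X (suc k) ≡ Y k ⊕ Y (suc k))
           (Y₀≡c⊕X₀ : Y 0 ≡ c ⊕ X 0) where

    -- Mutual induction along the sequence: each `swap` exchanges `X` and `Y`, so the direction of
    -- the shift alternates with the parity of the index.
    even-shift : ∀ q → Y (q * 2) ≡ c ⊕ X (q * 2)
    odd-shift : ∀ q → X (suc (q * 2)) ≡ c ⊕ Y (suc (q * 2))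
    even-shift zero    = Y₀≡c⊕X₀
    -- From an odd index the roles are reversed, hence the equation of sums is read backwards.
    even-shift (suc q) = swap (sym (sums (suc (q * 2)))) (odd-shift q)
    odd-shift q = swap (sums (q * 2)) (even-shift q)

    -- Adding `c` to both sides of what `swap` yields undoes the exchange of roles, so one direction
    -- of shift persists at every index.
    involutive-shift : c ⊕ c ≡ 0# → ∀ k → Y k ≡ c ⊕ X k
    involutive-shift c⊕c≡0 zero    = Y₀≡c⊕X₀
    involutive-shift c⊕c≡0 (suc k) = begin
      Y (suc k)              ≡⟨ ⊕-identityˡ _ ⟨
      0# ⊕ Y (suc k)         ≡⟨ cong (_⊕ Y (suc k)) c⊕c≡0 ⟨
      (c ⊕ c) ⊕ Y (suc k)    ≡⟨ ⊕-assoc c c _ ⟩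
      c ⊕ (c ⊕ Y (suc k))    ≡⟨ cong (c ⊕_) (swap (sums k) (involutive-shift c⊕c≡0 k)) ⟨
      c ⊕ X (suc k)          ∎

    -- An odd index carries the reversed shift. Periodicity brings it back to index 0, where it
    -- meets the original one; cancelling `X 0` leaves the claim.
    odd-period⇒c⊕c≡0 : ∀ q → X (suc (q * 2)) ≡ X 0 → Y (suc (q * 2)) ≡ Y 0 → c ⊕ c ≡ 0#
    odd-period⇒c⊕c≡0 q X-per Y-per = identityˡ-unique (c ⊕ c) (X 0) (begin
      (c ⊕ c) ⊕ X 0          ≡⟨ ⊕-assoc c c (X 0) ⟩
      c ⊕ (c ⊕ X 0)          ≡⟨ cong (c ⊕_) Y₀≡c⊕X₀ ⟨
      c ⊕ Y 0                ≡⟨ cong (c ⊕_) Y-per ⟨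
      c ⊕ Y (suc (q * 2))    ≡⟨ odd-shift q ⟨
      X (suc (q * 2))        ≡⟨ X-per ⟩
      X 0                    ∎)

  -- Fibres of `D`

  module _ (n : ℕ) .{{_ : NonZero n}} where

    lookup-ext : {x y : Vec (ℤ/ m) n} → (∀ i → lookup x i ≡ lookup y i) → x ≡ y
    lookup-ext eq = Pointwise-≡⇒≡ (ext eq)

    -- The vector unrolled into a periodic sequence, so that inductions run over ℕ without a case
    -- for the last position.
    cyclic : Vec (ℤ/ m) n → ℕ → ℤ/ m
    cyclic x k = lookup x (k mod n)

    cyclic-period : ∀ x → cyclic x n ≡ cyclic x 0
    cyclic-period x = cong (lookup x)
      (mod-cong-% n (trans (n%n≡0 n) (sym (m<n⇒m%n≡m (>-nonZero⁻¹ n)))))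

    lookup-D : ∀ x k → lookup (D x) (k mod n) ≡ cyclic x k ⊕ cyclic x (suc k)
    lookup-D x k = trans (lookup∘tabulate _ (k mod n))
      (cong (λ i → cyclic x k ⊕ lookup x i) (next-mod k n))

    lookup-addHalf : ∀ (x : Vec (ℤ/ m) n) i → lookup (addHalf x) i ≡ half m ⊕ lookup x i
    lookup-addHalf x i = lookup-map i (half m ⊕_) x

    -- Each entry of `D` sums two entries, so two halves are added, and they cancel.
    D-addHalf : 2 ∣ m → (x : Vec (ℤ/ m) n) → D (addHalf x) ≡ D x
    D-addHalf 2∣m x = tabulate-cong λ i → begin
      lookup (addHalf x) i ⊕ lookup (addHalf x) (next i)
        ≡⟨ cong₂ _⊕_ (lookup-addHalf x i) (lookup-addHalf x (next i)) ⟩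
      (half m ⊕ lookup x i) ⊕ (half m ⊕ lookup x (next i))
        ≡⟨ interchange (half m) (lookup x i) (half m) (lookup x (next i)) ⟩
      (half m ⊕ half m) ⊕ (lookup x i ⊕ lookup x (next i))
        ≡⟨ cong (_⊕ (lookup x i ⊕ lookup x (next i))) (half⊕half≡0 2∣m) ⟩
      0# ⊕ (lookup x i ⊕ lookup x (next i))
        ≡⟨ ⊕-identityˡ _ ⟩
      lookup x i ⊕ lookup x (next i) ∎

    addHalf-≢ : 2 ∣ m → (x : Vec (ℤ/ m) n) → addHalf x ≢ x
    addHalf-≢ 2∣m x eq = half≢0 2∣m (identityˡ-unique (half m) (lookup x i)
      (trans (sym (lookup-addHalf x i)) (cong (λ z → lookup z i) eq)))
      -- One position is enough to tell the vectors apart, and position 0 exists because `n` is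
      -- nonzero.
      where i = 0 mod n

    D-fibre : ∀ q → n ≡ suc (q * 2) → 2 ∣ m → (x y : Vec (ℤ/ m) n) → D x ≡ D y →
              y ≡ x ⊎ y ≡ addHalf x
    D-fibre q n≡ 2∣m x y Dx≡Dy =
      Sum.map zero-shift half-shift (c⊕c≡0⇒c≡0⊎c≡half 2∣m c c⊕c≡0)
      where
      c : ℤ/ m
      -- The difference at position 0 is the only possible value of a common shift from `x` to `y`.
      c = cyclic y 0 ⊕ (⊖ cyclic x 0)

      y₀≡c⊕x₀ : cyclic y 0 ≡ c ⊕ cyclic x 0
      y₀≡c⊕x₀ = sym (begin
        (cyclic y 0 ⊕ (⊖ cyclic x 0)) ⊕ cyclic x 0  ≡⟨ ⊕-assoc _ _ _ ⟩
        cyclic y 0 ⊕ ((⊖ cyclic x 0) ⊕ cyclic x 0)  ≡⟨ cong (cyclic y 0 ⊕_) (⊕-inverseˡ _) ⟩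
        cyclic y 0 ⊕ 0#                             ≡⟨ G.identityʳ _ ⟩
        cyclic y 0                                  ∎)

      sums : ∀ k → cyclic x k ⊕ cyclic x (suc k) ≡ cyclic y k ⊕ cyclic y (suc k)
      sums k = trans (sym (lookup-D x k))
        (trans (cong (λ z → lookup z (k mod n)) Dx≡Dy) (lookup-D y k))

      c⊕c≡0 : c ⊕ c ≡ 0#
      c⊕c≡0 = odd-period⇒c⊕c≡0 (cyclic x) (cyclic y) c sums y₀≡c⊕x₀ q (period x) (period y)
        where
        period : ∀ z → cyclic z (suc (q * 2)) ≡ cyclic z 0
        period z = trans (cong (cyclic z) (sym n≡)) (cyclic-period z)

      shift : ∀ i → lookup y i ≡ c ⊕ lookup x i
      -- The statement at the unrolled index `toℕ i` is carried back to the position `i`.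
      shift i = subst (λ j → lookup y j ≡ c ⊕ lookup x j) (toℕ-mod-id i)
        (involutive-shift (cyclic x) (cyclic y) c sums y₀≡c⊕x₀ c⊕c≡0 (toℕ i))

      zero-shift : c ≡ 0# → y ≡ x
      zero-shift c≡0 = lookup-ext λ i → begin
        lookup y i            ≡⟨ shift i ⟩
        c ⊕ lookup x i        ≡⟨ cong (_⊕ lookup x i) c≡0 ⟩
        0# ⊕ lookup x i       ≡⟨ ⊕-identityˡ _ ⟩
        lookup x i            ∎

      half-shift : c ≡ half m → y ≡ addHalf x
      half-shift c≡half = lookup-ext λ i → begin
        lookup y i            ≡⟨ shift i ⟩
        c ⊕ lookup x i        ≡⟨ cong (_⊕ lookup x i) c≡half ⟩
        half m ⊕ lookup x i   ≡⟨ lookup-addHalf x i ⟨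
        lookup (addHalf x) i  ∎

-- Odd numbers and the final count of predecessors

odd-form : ∀ n → 2 ∤ n → ∃[ q ] n ≡ suc (q * 2)
odd-form zero          2∤n = ⊥-elim (2∤n (divides 0 refl))
odd-form (suc zero)    2∤n = 0 , refl
odd-form (suc (suc n)) 2∤n
  -- Oddness descends by two: if 2 divided `n`, it would divide `suc (suc n)`.
  with q , n≡ ← odd-form n (λ { (divides q n≡) → 2∤n (divides (suc q) (cong (λ k → suc (suc k)) n≡)) })
  = suc q , cong (λ k → suc (suc k)) n≡

theorem2p1 : (n m : ℕ) .{{_ : NonZero n}} .{{_ : NonZero m}} →
    1 ≤ n → 2 ∤ n → 2 ≤ m → 2 ∣ m →
    (v : Vec (ℤ/ m) n) →
    ((∃[ w ] w IsPredecessorOf v) → ExactlyTwo (_IsPredecessorOf v))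
    × ((x : Vec (ℤ/ m) n) → x IsPredecessorOf v →
    addHalf x IsTheOther (_IsPredecessorOf v) Than x)
theorem2p1 n m _ 2∤n _ 2∣m v = exactlyTwo , other
  where
  -- Serves both claims: any chosen predecessor `x` determines the full list of candidates.
  fibre : ∀ x y → D x ≡ v → D y ≡ v → y ≡ x ⊎ y ≡ addHalf x
  fibre x y Dx≡v Dy≡v with q , n≡ ← odd-form n 2∤n =
    D-fibre m n q n≡ 2∣m x y (trans Dx≡v (sym Dy≡v))

  exactlyTwo : (∃[ w ] w IsPredecessorOf v) → ExactlyTwo (_IsPredecessorOf v)
  exactlyTwo (w , Dw≡v) =
    w , addHalf w , ≢-sym (addHalf-≢ m n 2∣m w) , Dw≡v ,
    trans (D-addHalf m n 2∣m w) Dw≡v , λ y → fibre w y Dw≡v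

  other : ∀ x → x IsPredecessorOf v → addHalf x IsTheOther (_IsPredecessorOf v) Than x
  other x Dx≡v =
    trans (D-addHalf m n 2∣m x) Dx≡v , addHalf-≢ m n 2∣m x ,
    λ y Dy≡v y≢x → fromInj₂ (λ y≡x → ⊥-elim (y≢x y≡x)) (fibre x y Dx≡v Dy≡v)
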